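{- Let $H$ be a graph. Every (triangle, $H$)-free graph is recolorable if and only if every (paw, $H$)-free graph is recolorable. Furthermore, every (triangle, $H$)-free graph is good if and only if every (paw, $H$)-free graph is good.
   Context: All graphs are finite and simple. A $k$-coloring of $G$ is a map $V(G)\to\{1,\dots,k\}$ giving adjacent vertices different values; $\chi(G)$ is the chromatic number, and a $\chi$-coloring of $G$ is a $\chi(G)$-coloring. $R_k(G)$ denotes the graph whose vertices are the $k$-colorings of $G$, two being adjacent if they differ in color on exactly one vertex. $G$ is recolorable if $R_\ell(G)$ is connected for all $\ell\ge\chi(G)+1$. A graph $G$ on $n$ vertices is good if there exists a $\chi$-coloring of $G$ which, for all $\ell\ge\chi(G)+1$, can be reached from any coloring in $R_\ell(G)$ by a path in $R_\ell(G)$ along which each vertex is recolored at most $n$ times. A graph is $(H_1,H_2)$-free if it has no induced subgraph isomorphic to $H_1$ or $H_2$. The triangle is $K_3$; the paw is a triangle together with one extra vertex adjacent to exactly one vertex of the triangle. -}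

module Defs where

open import Data.Empty using (⊥)
open import Data.Fin.Base using (Fin; zero; suc; inject≤)
open import Data.Fin.Properties using (_≟_; inject≤-injective)
open import Data.List.Base using (List; []; _∷_)
open import Data.List.Relation.Unary.Unique.Setoid using (Unique)
open import Data.Nat.Base using (ℕ; zero; suc; _≤_; _<_)
open import Data.Nat.Properties using (<⇒≤)
open import Data.Product using (Σ-syntax; ∃-syntax; ∃!; _×_)
open import Function.Bundles using (_⇔_)
open import Function.Definitions using (Injective)
open import Level using (0ℓ)
open import Relation.Binary.Bundles using (Setoid)
open import Relation.Binary.Core using (Rel)
open import Relation.Binary.Definitions using (Symmetric; Irreflexive; Decidable)
open import Relation.Binary.PropositionalEquality
  using (_≡_; _≢_; _≗_; refl; ≢-sym; _→-setoid_)
import Relation.Binary.Construct.On as On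
open import Relation.Nullary using (¬_; yes; no)
open import Relation.Nullary.Decidable using (¬?)

-- Finite simple graphs, up to a labelling of the vertices.  Decidability of
-- adjacency is automatic classically and is part of "finite graph" here.
record Graph : Set₁ where
  field
    order  : ℕ
    Adj    : Rel (Fin order) 0ℓ
    symm   : Symmetric Adj
    irrefl : Irreflexive _≡_ Adj
    adj?   : Decidable Adj

  Vertex : Set
  Vertex = Fin order

open Graph public using (order; Vertex)

complete : ℕ → Graph
complete n = record
  { order  = n
  ; Adj    = _≢_
  ; symm   = ≢-sym
  ; irrefl = λ u≡v u≢v → u≢v u≡v
  ; adj?   = λ u v → ¬? (u ≟ v)
  }

-- The new vertex is zero; it is adjacent to (the copy of) w only.
addLeaf : (G : Graph) → Vertex G → Graph
addLeaf G w = record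
  { order  = suc (order G)
  ; Adj    = A
  ; symm   = λ {u} {v} → A-sym u v
  ; irrefl = λ {u} {v} → A-irrefl u v
  ; adj?   = A?
  }
  where
  open Graph G using (Adj; symm; irrefl; adj?)

  A : Rel (Fin (suc (order G))) 0ℓ
  A zero    zero    = ⊥
  A zero    (suc v) = v ≡ w
  A (suc u) zero    = u ≡ w
  A (suc u) (suc v) = Adj u v

  A-sym : ∀ u v → A u v → A v u
  A-sym zero    (suc v) e = e
  A-sym (suc u) zero    e = e
  A-sym (suc u) (suc v) e = symm e

  A-irrefl : ∀ u v → u ≡ v → ¬ A u v
  A-irrefl (suc u) .(suc u) refl e = irrefl refl e

  A? : Decidable A
  A? zero    zero    = no λ ()
  A? zero    (suc v) = v ≟ w
  A? (suc u) zero    = u ≟ w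
  A? (suc u) (suc v) = adj? u v

triangle : Graph
triangle = complete 3

paw : Graph
paw = addLeaf triangle zero

-- The embedding is an isomorphism of H onto the subgraph of G induced by
-- its image.
record _InducedIn_ (H G : Graph) : Set where
  field
    embed     : Vertex H → Vertex G
    injective : Injective _≡_ _≡_ embed
    adjacency : ∀ u v → Graph.Adj H u v ⇔ Graph.Adj G (embed u) (embed v)

Free : Graph → Graph → Graph → Set
Free H₁ H₂ G = ¬ (H₁ InducedIn G) × ¬ (H₂ InducedIn G)

record Coloring (G : Graph) (k : ℕ) : Set where
  field
    color  : Vertex G → Fin k
    proper : ∀ {u v} → Graph.Adj G u v → color u ≢ color v

open Coloring public using (color)

-- Colorings are maps, so they are compared pointwise.
coloringSetoid : Graph → ℕ → Setoid 0ℓ 0ℓ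
coloringSetoid G k = On.setoid (Vertex G →-setoid Fin k) (color {G} {k})

-- χ(G) = k
IsChromaticNumber : Graph → ℕ → Set
IsChromaticNumber G k = Coloring G k × (∀ j → j < k → ¬ Coloring G j)

-- A k-coloring regarded as an ℓ-coloring, via {1,…,k} ⊆ {1,…,ℓ}.
weaken : ∀ {G k ℓ} → k ≤ ℓ → Coloring G k → Coloring G ℓ
weaken k≤ℓ c = record
  { color  = λ v → inject≤ (color c v) k≤ℓ
  ; proper = λ e eq → Coloring.proper c e (inject≤-injective k≤ℓ k≤ℓ _ _ eq)
  }

module _ {G : Graph} {k : ℕ} where

  -- The adjacency relation of R_k(G).
  RAdj : Rel (Coloring G k) 0ℓ
  RAdj c d = ∃! _≡_ λ v → color c v ≢ color d v

  data Walk : Rel (Coloring G k) 0ℓ where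
    done : ∀ {c d} → color c ≗ color d → Walk c d
    step : ∀ {c c′ d} → RAdj c c′ → Walk c′ d → Walk c d

  visited : ∀ {c d} → Walk c d → List (Coloring G k)
  visited {c} (done _)   = c ∷ []
  visited {c} (step _ w) = c ∷ visited w

  recolorings : ∀ {c d} → Vertex G → Walk c d → ℕ
  recolorings v (done _) = 0
  recolorings v (step {c} {c′} _ w) with color c v ≟ color c′ v
  ... | yes _ = recolorings v w
  ... | no  _ = suc (recolorings v w)

  record Path (c d : Coloring G k) : Set where
    field
      walk   : Walk c d
      simple : Unique (coloringSetoid G k) (visited walk)

RConnected : Graph → ℕ → Set
RConnected G k = (c d : Coloring G k) → Path c d

Recolorable : Graph → Set
Recolorable G =
  ∃[ χ ] IsChromaticNumber G χ × (∀ ℓ → χ < ℓ → RConnected G ℓ)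

Good : Graph → Set
Good G =
  ∃[ χ ] IsChromaticNumber G χ ×
  (Σ[ c ∈ Coloring G χ ]
    (∀ ℓ (χ<ℓ : χ < ℓ) (d : Coloring G ℓ) →
      Σ[ p ∈ Path d (weaken (<⇒≤ χ<ℓ) c) ]
        (∀ v → recolorings v (Path.walk p) ≤ order G)))

{-# OPTIONS --safe #-}
-- The triangle is an induced subgraph of the paw, so only the passage from triangle-free to
-- paw-free graphs needs work.  Let G be paw-free with a triangle.  Every vertex adjacent to one
-- vertex of a triangle is adjacent to a second one.  Hence if vz is an edge of a triangle and
-- u ≠ v is adjacent to z but not to v, then N(v) ⊆ N(u), and v can be deleted: first give v the
-- color of u, then let v follow u.  If there is no such configuration, the closed neighborhood
-- of a triangle vertex is a component of G and a clique, on which colorings are permuted using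
-- a spare color, and it can be split off.  (Grouping non-adjacent vertices of one component in
-- this way replaces Olariu's theorem that the components containing triangles are complete
-- multipartite.)
module Submission where

open import Defs
open import Data.Empty using (⊥; ⊥-elim)
open import Data.Fin.Base using (Fin; zero; suc)
open import Data.Fin.Properties
  using (_≟_; any?; all?; pigeonhole; injective⇒≤; inject≤-idempotent; <⇒≢)
open import Data.List.Base using (List; []; _∷_; length; filter; lookup; allFin)
open import Data.List.Membership.Propositional using (_∉_; lose)
open import Data.List.Membership.Propositional.Properties
  using (∈-filter⁺; ∈-filter⁻; ∈-lookup; ∈-allFin)
open import Data.List.Properties using (length-tabulate; filter-notAll)
import Data.List.Relation.Unary.All as All
open import Data.List.Relation.Unary.AllPairs using ([]; _∷_)
open import Data.List.Relation.Unary.All.Properties using (¬Any⇒All¬)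
open import Data.List.Relation.Unary.Any as Any using (here; there)
open import Data.List.Relation.Unary.Any.Properties using (lookup-index)
import Data.List.Relation.Unary.Unique.Propositional as Propositional
open import Data.List.Relation.Unary.Unique.Propositional.Properties using (allFin⁺; filter⁺)
open import Data.List.Relation.Unary.Unique.Setoid using (Unique)
open import Data.Maybe.Base using (Maybe; just; nothing; maybe′)
open import Data.Maybe.Relation.Binary.Pointwise using (Pointwise; just; nothing)
open import Data.Nat.Base using (ℕ; zero; suc; _+_; _≤_; _<_; z≤n; s≤s; _⊔_)
open import Data.Nat.Induction using (<-wellFounded)
open import Data.Nat.Properties
  using (≤-refl; ≤-reflexive; ≤-trans; <⇒≤; +-mono-≤; +-identityʳ; +-assoc; m≤m⊔n; m≤n⊔m; m≤n+m;
         ⊔-sel; ≤-<-trans)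
open import Data.Product using (Σ-syntax; ∃-syntax; _×_; _,_; proj₁; proj₂)
open import Data.Sum.Base using (_⊎_; inj₁; inj₂; [_,_]′)
open import Data.Unit.Base using (⊤; tt)
open import Data.Vec.Functional using (updateAt)
open import Data.Vec.Functional.Properties using (updateAt-updates; updateAt-minimal)
open import Function.Base using (_∘_; const)
open import Function.Bundles using (_⇔_; mk⇔; Equivalence)
open import Function.Definitions using (Injective)
open import Function.Construct.Composition using (_⇔-∘_)
open import Induction.WellFounded using (Acc; acc)
open import Relation.Binary.PropositionalEquality
  using (_≡_; _≢_; _≗_; refl; sym; trans; cong; subst; subst₂; ≢-sym)
open import Relation.Nullary using (¬_; Dec; yes; no; contradiction)
open import Relation.Nullary.Decidable using (¬?; _×-dec_; _⊎-dec_; decidable-stable)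
import Relation.Unary as Unary

-- Walks in R_k(G)

-- The share of a single step in `recolorings`, as a separate number that can be rewritten and
-- bounded.
changes : ∀ {k} → Fin k → Fin k → ℕ
changes a b with a ≟ b
... | yes _ = 0
... | no  _ = 1

changes-≡ : ∀ {k} {a b : Fin k} → a ≡ b → changes a b ≡ 0
changes-≡ {a = a} {b} eq with a ≟ b
... | yes _ = refl
... | no ne = contradiction eq ne

changes≤1 : ∀ {k} (a b : Fin k) → changes a b ≤ 1
changes≤1 a b with a ≟ b
... | yes _ = z≤n
... | no  _ = s≤s z≤n

-- Equality in the triangle inequality of the discrete metric: a stop at one of the two end colors
-- is no detour.
changes-via : ∀ {k} {a b c : Fin k} → b ≡ a ⊎ b ≡ c → changes a b + changes b c ≡ changes a c
changes-via {a = a} (inj₁ refl) rewrite changes-≡ {a = a} refl = refl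
changes-via {c = c} (inj₂ refl) rewrite changes-≡ {a = c} refl = +-identityʳ _

module _ {G : Graph} {k : ℕ} where

  open Graph G using (Adj; symm; irrefl)

  recolorings-step : ∀ {c c′ d : Coloring G k} v (r : RAdj c c′) (w : Walk c′ d) →
    recolorings v (step {c = c} {c′} r w) ≡ changes (color c v) (color c′ v) + recolorings v w
  recolorings-step {c} {c′} v r w with color c v ≟ color c′ v
  ... | yes _ = refl
  ... | no  _ = refl

  RAdj-respˡ : {c c′ d : Coloring G k} → color c ≗ color c′ → RAdj c′ d → RAdj c d
  RAdj-respˡ eq (v , ne , unique) =
    v , ne ∘ trans (sym (eq v)) , λ {u} ne′ → unique (ne′ ∘ trans (eq u))

  RAdj-sym : {c d : Coloring G k} → RAdj c d → RAdj d c
  RAdj-sym (v , ne , unique) = v , ≢-sym ne , λ ne′ → unique (≢-sym ne′)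

  -- Colorings are compared pointwise and carry proofs, so a walk has to be moved to a pointwise
  -- equal start by hand.
  walk-respˡ : {c c′ d : Coloring G k} → color c ≗ color c′ → Walk c′ d → Walk c d
  walk-respˡ         eq (done eq′) = done λ v → trans (eq v) (eq′ v)
  walk-respˡ {c} {c′} eq (step {c′ = e} r w) = step (RAdj-respˡ {c} {c′} {e} eq r) w

  recolorings-respˡ : ∀ {c c′ d : Coloring G k} (eq : color c ≗ color c′) (w : Walk c′ d) v →
    recolorings v (walk-respˡ {c} eq w) ≡ recolorings v w
  recolorings-respˡ eq (done _) v = refl
  recolorings-respˡ {c} {c′} {d} eq (step {c′ = e} r w) v =
    trans (recolorings-step {c} {e} {d} v (RAdj-respˡ {c} {c′} {e} eq r) w)
      (trans (cong (λ a → changes a (color e v) + recolorings v w) (eq v))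
        (sym (recolorings-step {c′} {e} {d} v r w)))

  infixr 5 _++_

  _++_ : {c d e : Coloring G k} → Walk c d → Walk d e → Walk c e
  done eq  ++ w′ = walk-respˡ eq w′
  step {c = c} {c′} r w ++ w′ = step {c = c} {c′} r (w ++ w′)

  recolorings-++ : ∀ {c d e : Coloring G k} (w : Walk c d) (w′ : Walk d e) v →
    recolorings v (w ++ w′) ≡ recolorings v w + recolorings v w′
  recolorings-++ {c} {d} {e} (done eq) w′ v = recolorings-respˡ {c} {d} {e} eq w′ v
  recolorings-++ {c} {d} {e} (step {c′ = c′} r w) w′ v =
    trans (recolorings-step {c} {c′} {e} v r (w ++ w′))
      (trans (cong (now +_) (recolorings-++ w w′ v))
        (trans (sym (+-assoc now _ _))
          (cong (_+ recolorings v w′) (sym (recolorings-step {c} {c′} {d} v r w)))))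
    where
    now = changes (color c v) (color c′ v)

  reverse : {c d : Coloring G k} → Walk c d → Walk d c
  reverse (done eq) = done (sym ∘ eq)
  reverse {c} (step {c′ = c′} r w) =
    reverse w ++ step {c = c′} {c} (RAdj-sym {c} {c′} r) (done λ _ → refl)

  -- Loop erasure

  private
    S = coloringSetoid G k
    open import Data.List.Membership.Setoid S using () renaming (_∈_ to _∈ₛ_)

  _≗?_ : (c d : Coloring G k) → Dec (color c ≗ color d)
  c ≗? d = all? λ v → color c v ≟ color d v

  visited-respˡ-unique : ∀ {c c′ d : Coloring G k} (eq : color c ≗ color c′) (w : Walk c′ d) →
    Unique S (visited w) → Unique S (visited (walk-respˡ {c} eq w))
  visited-respˡ-unique eq (done _) (px ∷ u) = All.[] ∷ u
  visited-respˡ-unique eq (step r w) (px ∷ u) =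
    All.map (λ ne eq′ → ne (λ v → trans (sym (eq v)) (eq′ v))) px ∷ u

  -- The part of the walk from the occurrence of `c` onwards is kept. Dropping the earlier steps
  -- raises no count, and a tail of a simple walk is simple.
  cut : ∀ {c c′ d : Coloring G k} (w : Walk c′ d) → Unique S (visited w) → c ∈ₛ visited w →
    Σ[ w′ ∈ Walk c d ] Unique S (visited w′) × (∀ v → recolorings v w′ ≤ recolorings v w)
  cut {c} {c′} {d} w@(done eq′) u (here eq) =
    walk-respˡ eq w , visited-respˡ-unique {c} eq w u , λ v → ≤-refl
  cut {c} {c′} {d} w@(step _ _) u (here eq) =
    walk-respˡ eq w , visited-respˡ-unique {c} eq w u
    , λ v → ≤-reflexive (recolorings-respˡ {c} {c′} {d} eq w v)
  cut {c} {c′} {d} (step {c′ = e} r w) (_ ∷ u) (there i) with cut {c} w u i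
  ... | w′ , u′ , le = w′ , u′ , λ v → ≤-trans (le v)
    (subst (recolorings v w ≤_) (sym (recolorings-step {c′} {e} {d} v r w)) (m≤n+m _ _))

  -- The constructions below produce walks, while the definitions ask for paths; the inequality lets
  -- bounds on walks carry over to paths.
  eraseLoops : ∀ {c d : Coloring G k} (w : Walk c d) →
    Σ[ p ∈ Path c d ] (∀ v → recolorings v (Path.walk p) ≤ recolorings v w)
  eraseLoops (done eq) = record { walk = done eq ; simple = All.[] ∷ [] } , λ v → ≤-refl
  eraseLoops {c} {d} (step {c′ = c′} r w) with eraseLoops w
  -- If `c` recurs on the simplified tail, the path starts at that occurrence and the current step
  -- is dropped.
  ... | p , le with Any.any? (c ≗?_) (visited (Path.walk p))
  ...   | yes i with cut {c} (Path.walk p) (Path.simple p) i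
  ...     | w′ , u′ , le′ = record { walk = w′ ; simple = u′ } , λ v →
    subst (recolorings v w′ ≤_) (sym (recolorings-step {c} {c′} {d} v r w))
      (≤-trans (≤-trans (le′ v) (le v)) (m≤n+m _ _))
  eraseLoops {c} {d} (step {c′ = c′} r w) | p , le | no ∉ =
    record { walk = step r (Path.walk p) ; simple = ¬Any⇒All¬ _ ∉ ∷ Path.simple p } , λ v →
    subst₂ _≤_ (sym (recolorings-step {c} {c′} {d} v r (Path.walk p)))
               (sym (recolorings-step {c} {c′} {d} v r w))
               (+-mono-≤ ≤-refl (le v))

  -- Recoloring one vertex, and sweeping to a compatible coloring

  recolor : (c : Coloring G k) (x : Vertex G) (a : Fin k) →
    (∀ {v} → Adj x v → color c v ≢ a) → Coloring G k
  recolor c x a free = record { color = color′ ; proper = λ {u} {v} → proper′ {u} {v} }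
    where
    color′ : Vertex G → Fin k
    color′ = updateAt (color c) x (const a)

    proper′ : ∀ {u v} → Adj u v → color′ u ≢ color′ v
    proper′ {u} {v} e eq with u ≟ x | v ≟ x
    ... | yes refl | yes refl = irrefl refl e
    ... | yes refl | no v≢x = free e (trans (sym (updateAt-minimal v x (color c) v≢x))
                                       (trans (sym eq) (updateAt-updates x (color c))))
    ... | no u≢x | yes refl = free (symm e) (trans (sym (updateAt-minimal u x (color c) u≢x))
                                              (trans eq (updateAt-updates x (color c))))
    ... | no u≢x | no v≢x = Coloring.proper c e
      (trans (sym (updateAt-minimal u x (color c) u≢x))
        (trans eq (updateAt-minimal v x (color c) v≢x)))

  -- A recoloring that changes nothing is not an edge of R_k(G), so it becomes the trivial walk.
  recolor-walk : ∀ c x a (free : ∀ {v} → Adj x v → color c v ≢ a) →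
    Σ[ w ∈ Walk c (recolor c x a free) ]
      (∀ v → recolorings v w ≤ changes (color c v) (color (recolor c x a free) v))
  recolor-walk c x a free with color c x ≟ a
  ... | yes eq = done same , λ v → z≤n
    where
    same : color c ≗ color (recolor c x a free)
    same v with v ≟ x
    ... | yes refl = trans eq (sym (updateAt-updates x (color c)))
    ... | no v≢x = sym (updateAt-minimal v x (color c) v≢x)
  ... | no ne = w , λ v → ≤-reflexive (trans
          (recolorings-step {c} {c′} {c′} v r (done λ _ → refl)) (+-identityʳ _))
    where
    c′ = recolor c x a free

    unique : ∀ {v} → color c v ≢ color c′ v → x ≡ v
    unique {v} ne′ with v ≟ x
    ... | yes v≡x = sym v≡x
    ... | no v≢x = contradiction (sym (updateAt-minimal v x (color c) v≢x)) ne′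

    r : RAdj c c′
    r = x , (λ eq → ne (trans eq (updateAt-updates x (color c)))) , unique

    w : Walk c c′
    w = step r (done λ _ → refl)

  -- No edge has equal colors when one end is read in `c` and the other in `d`, so every mixture of
  -- the two colorings is proper. The vertices can be switched one at a time, in any order. Only
  -- those in `xs` may still differ.
  sweepList : ∀ (xs : List (Vertex G)) (c d : Coloring G k) →
    (∀ {u v} → Adj u v → color c u ≢ color d v) → (∀ v → v ∉ xs → color c v ≡ color d v) →
    Σ[ w ∈ Walk c d ] (∀ v → recolorings v w ≤ changes (color c v) (color d v))
  sweepList []       c d _ agree = done (λ v → agree v λ ()) , λ v → z≤n
  sweepList (x ∷ xs) c d compatible agree = proj₁ first ++ proj₁ rest , bound
    where
    free : ∀ {v} → Adj x v → color c v ≢ color d x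
    free e = compatible (symm e)

    c′ = recolor c x (color d x) free

    at-x : color c′ x ≡ color d x
    at-x = updateAt-updates x (color c)

    off-x : ∀ {v} → v ≢ x → color c′ v ≡ color c v
    off-x {v} = updateAt-minimal v x (color c)

    compatible′ : ∀ {u v} → Adj u v → color c′ u ≢ color d v
    compatible′ {u} e eq with u ≟ x
    ... | yes refl = Coloring.proper d e (trans (sym at-x) eq)
    ... | no u≢x = compatible e (trans (sym (off-x u≢x)) eq)

    agree′ : ∀ v → v ∉ xs → color c′ v ≡ color d v
    agree′ v v∉ with v ≟ x
    ... | yes refl = at-x
    ... | no v≢x = trans (off-x v≢x) (agree v λ { (here v≡x) → v≢x v≡x ; (there v∈) → v∉ v∈ })

    first = recolor-walk c x (color d x) free
    rest  = sweepList xs c′ d compatible′ agree′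

    -- The intermediate color of a vertex is one of its end colors, so the counts of the two walks
    -- add up without loss.
    between : ∀ v → color c′ v ≡ color c v ⊎ color c′ v ≡ color d v
    between v with v ≟ x
    ... | yes refl = inj₂ at-x
    ... | no v≢x = inj₁ (off-x v≢x)

    bound : ∀ v → recolorings v (proj₁ first ++ proj₁ rest) ≤ changes (color c v) (color d v)
    bound v = subst₂ _≤_ (sym (recolorings-++ (proj₁ first) (proj₁ rest) v))
      (changes-via (between v)) (+-mono-≤ (proj₂ first v) (proj₂ rest v))

  sweep : ∀ (c d : Coloring G k) → (∀ {u v} → Adj u v → color c u ≢ color d v) →
    Σ[ w ∈ Walk c d ] (∀ v → recolorings v w ≤ changes (color c v) (color d v))
  sweep c d compatible =
    sweepList (allFin (order G)) c d compatible λ v v∉ → contradiction (∈-allFin v) v∉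

-- Pulling walks back along partial homomorphisms

-- `Pointwise` never relates `just` to `nothing`, so no edge joins the domain of `r` to its
-- complement, and colors on the two sides can be chosen independently.
IsPartialHom : (G H : Graph) → (Vertex G → Maybe (Vertex H)) → Set
IsPartialHom G H r = ∀ {u v} → Graph.Adj G u v → Pointwise (Graph.Adj H) (r u) (r v)

module PullBack {G H : Graph} (r : Vertex G → Maybe (Vertex H)) (hom : IsPartialHom G H r)
                {k : ℕ} (base : Coloring G k) where

  overlay : Coloring H k → Coloring G k
  overlay e = record { color = color′ ; proper = λ {u} {v} → proper′ {u} {v} }
    where
    color′ : Vertex G → Fin k
    color′ v = maybe′ (color e) (color base v) (r v)

    proper′ : ∀ {u v} → Graph.Adj G u v → color′ u ≢ color′ v
    proper′ {u} {v} a with r u | r v | hom a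
    ... | just _  | just _  | just a′ = Coloring.proper e a′
    ... | nothing | nothing | nothing = Coloring.proper base a

  -- Only one vertex of `H` changes color, and `H` has no loops. Hence one end of the image of an
  -- edge keeps its color, and properness of `e` or `e′` applies.
  overlay-compatible : ∀ {e e′ : Coloring H k} → RAdj e e′ →
    ∀ {u v} → Graph.Adj G u v → color (overlay e) u ≢ color (overlay e′) v
  overlay-compatible {e} {e′} (z , _ , unique) {u} {v} a with r u | r v | hom a
  ... | nothing | nothing | nothing = Coloring.proper base a
  ... | just x  | just y  | just a′ with color e x ≟ color e′ x
  ...   | yes same = λ eq → Coloring.proper e′ a′ (trans (sym same) eq)
  ...   | no x-moves with color e y ≟ color e′ y
  ...     | yes same = λ eq → Coloring.proper e a′ (trans eq (sym same))
  ...     | no y-moves =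
    contradiction a′ (Graph.irrefl H (trans (sym (unique x-moves)) (unique y-moves)))

  -- A step at a vertex of `H` lifts to a sweep over its fiber. A vertex thus changes at most as
  -- often as its image, and never outside the domain of `r`, hence the default 0.
  pullBack : ∀ {e e′ : Coloring H k} (w : Walk e e′) (c c′ : Coloring G k) →
    color c ≗ color (overlay e) → color c′ ≗ color (overlay e′) →
    Σ[ w′ ∈ Walk c c′ ] (∀ v → recolorings v w′ ≤ maybe′ (λ x → recolorings x w) 0 (r v))
  pullBack {e} {e′} (done eq) c c′ c≗ c′≗ =
    done (λ v → trans (c≗ v) (trans (over v) (sym (c′≗ v)))) , λ v → z≤n
    where
    over : color (overlay e) ≗ color (overlay e′)
    over v with r v
    ... | just x  = eq x
    ... | nothing = refl
  pullBack {e} {e′} (step {c′ = e₁} s w) c c′ c≗ c′≗ = proj₁ first ++ proj₁ rest , bound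
    where
    first = sweep c (overlay e₁) λ {u} a eq →
      overlay-compatible {e} {e₁} s a (trans (sym (c≗ u)) eq)

    rest = pullBack w (overlay e₁) c′ (λ _ → refl) c′≗

    total : ∀ v → changes (color c v) (color (overlay e₁) v) + maybe′ (λ x → recolorings x w) 0 (r v)
                  ≡ maybe′ (λ x → recolorings x (step s w)) 0 (r v)
    total v rewrite c≗ v with r v
    ... | just x  = sym (recolorings-step {c = e} {e₁} {e′} x s w)
    ... | nothing = trans (+-identityʳ _) (changes-≡ refl)

    bound : ∀ v → recolorings v (proj₁ first ++ proj₁ rest)
                  ≤ maybe′ (λ x → recolorings x (step s w)) 0 (r v)
    bound v = subst₂ _≤_ (sym (recolorings-++ (proj₁ first) (proj₁ rest) v)) (total v)
      (+-mono-≤ (proj₂ first v) (proj₂ rest v))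

-- Induced subgraphs

InducedIn-trans : ∀ {F G H} → F InducedIn G → G InducedIn H → F InducedIn H
InducedIn-trans i j = record
  { embed     = J.embed ∘ I.embed
  ; injective = I.injective ∘ J.injective
  ; adjacency = λ u v → J.adjacency (I.embed u) (I.embed v) ⇔-∘ I.adjacency u v
  }
  where
  module I = _InducedIn_ i
  module J = _InducedIn_ j

restrict : ∀ {H G k} → H InducedIn G → Coloring G k → Coloring H k
restrict i c = record
  { color  = color c ∘ embed
  ; proper = λ {u} {v} → Coloring.proper c ∘ Equivalence.to (adjacency u v)
  }
  where open _InducedIn_ i

lookup-injective : ∀ {A : Set} {xs : List A} → Propositional.Unique xs →
  Injective _≡_ _≡_ (lookup xs)
lookup-injective (_  ∷ _) {zero}  {zero}  _  = refl
lookup-injective (px ∷ _) {zero}  {suc j} eq = contradiction eq (All.lookup px (∈-lookup j))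
lookup-injective (px ∷ _) {suc i} {zero}  eq = contradiction (sym eq) (All.lookup px (∈-lookup i))
lookup-injective (_  ∷ u) {suc i} {suc j} eq = cong suc (lookup-injective u eq)

module Induced (G : Graph) {S : Vertex G → Set} (S? : Unary.Decidable S) where

  open Graph G using (Adj; symm; irrefl; adj?)

  private
    members : List (Vertex G)
    members = filter S? (allFin (order G))

    injective : Injective _≡_ _≡_ (lookup members)
    injective = lookup-injective (filter⁺ S? (allFin⁺ (order G)))

  -- Vertices must form some `Fin n`, so they are the positions in the list of members of `S`.
  graph : Graph
  graph = record
    { order  = length members
    ; Adj    = λ i j → Adj (lookup members i) (lookup members j)
    ; symm   = symm
    ; irrefl = irrefl ∘ cong (lookup members)
    ; adj?   = λ i j → adj? (lookup members i) (lookup members j)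
    }

  inclusion : graph InducedIn G
  inclusion = record
    { embed     = lookup members
    ; injective = injective
    ; adjacency = λ _ _ → mk⇔ (λ a → a) (λ a → a)
    }

  open _InducedIn_ inclusion public using (embed)

  embed∈ : ∀ i → S (embed i)
  embed∈ i = proj₂ (∈-filter⁻ S? {xs = allFin (order G)} (∈-lookup i))

  preimage : ∀ {v} → S v → Vertex graph
  preimage s = Any.index (∈-filter⁺ S? (∈-allFin _) s)

  embed-preimage : ∀ {v} (s : S v) → embed (preimage s) ≡ v
  embed-preimage s = sym (lookup-index (∈-filter⁺ S? (∈-allFin _) s))

  preimage-adj : ∀ {u v} (s : S u) (t : S v) → Adj u v → Graph.Adj graph (preimage s) (preimage t)
  preimage-adj s t = subst₂ Adj (sym (embed-preimage s)) (sym (embed-preimage t))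

  order≤ : order graph ≤ order G
  order≤ = injective⇒≤ injective

  order< : ∀ {v} → ¬ S v → order graph < order G
  order< {v} v∉S = subst (order graph <_) (length-tabulate {n = order G} (λ i → i))
    (filter-notAll S? (allFin (order G)) (lose (∈-allFin v) v∉S))

  project : Vertex G → Maybe (Vertex graph)
  project v with S? v
  ... | yes s = just (preimage s)
  ... | no  _ = nothing

  project-hom : (∀ {u v} → Adj u v → S u → S v) → IsPartialHom G graph project
  project-hom closed {u} {v} a with S? u | S? v
  ... | yes s | yes t = just (preimage-adj s t a)
  ... | yes s | no ¬t = contradiction (closed a s) ¬t
  ... | no ¬s | yes t = contradiction (closed (symm a) t) ¬s
  ... | no _  | no _  = nothing

  -- The left side is the color of `v` when the restriction of `c` is overlaid on `c`; this lets
  -- `pullBack` start at `c`.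
  project-restrict : ∀ {k} (c : Coloring G k) v →
    maybe′ (color (restrict inclusion c)) (color c v) (project v) ≡ color c v
  project-restrict c v with S? v
  ... | yes s = cong (color c) (embed-preimage s)
  ... | no  _ = refl

-- For Counted = ⊤ this is goodness, and for Counted = ⊥ it is recolorability.

Collapsible : Set → Graph → Set
Collapsible Counted G =
  ∃[ χ ] IsChromaticNumber G χ ×
  (Σ[ c ∈ Coloring G χ ]
    (∀ ℓ (χ<ℓ : χ < ℓ) (d : Coloring G ℓ) →
      Σ[ w ∈ Walk d (weaken (<⇒≤ χ<ℓ) c) ]
        (Counted → ∀ v → recolorings v w ≤ order G)))

good⇒collapsible : ∀ {G} → Good G → Collapsible ⊤ G
good⇒collapsible (χ , isχ , c , reach) = χ , isχ , c , λ ℓ χ<ℓ d →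
  let p , le = reach ℓ χ<ℓ d in Path.walk p , λ _ → le

collapsible⇒good : ∀ {G} → Collapsible ⊤ G → Good G
collapsible⇒good (χ , isχ , c , reach) = χ , isχ , c , λ ℓ χ<ℓ d →
  let w , le = reach ℓ χ<ℓ d
      p , le′ = eraseLoops w
  in p , λ v → ≤-trans (le′ v) (le tt v)

recolorable⇒collapsible : ∀ {G} → Recolorable G → Collapsible ⊥ G
recolorable⇒collapsible (χ , isχ@(c , _) , connected) = χ , isχ , c , λ ℓ χ<ℓ d →
  Path.walk (connected ℓ χ<ℓ d (weaken (<⇒≤ χ<ℓ) c)) , λ ()

-- Two colorings are joined through the common target, the second walk being reversed.
collapsible⇒recolorable : ∀ {G} → Collapsible ⊥ G → Recolorable G
collapsible⇒recolorable (χ , isχ , c , reach) = χ , isχ , λ ℓ χ<ℓ d e →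
  proj₁ (eraseLoops (proj₁ (reach ℓ χ<ℓ d) ++ reverse (proj₁ (reach ℓ χ<ℓ e))))

-- Complete graphs

-- If all colors were used, choosing a vertex for each would map `ℓ` colors injectively to `n`
-- vertices, against the pigeonhole principle.
freshColor : ∀ {n ℓ} → n < ℓ → (f : Fin n → Fin ℓ) → ∃[ a ] (∀ v → f v ≢ a)
freshColor {n} {ℓ} n<ℓ f with any? (λ a → all? λ v → ¬? (f v ≟ a))
... | yes fresh = fresh
... | no  none  =
  ⊥-elim (<⇒≢ i<j (trans (sym (proj₂ (used i))) (trans (cong f same) (proj₂ (used j)))))
  where
  used : ∀ a → ∃[ v ] f v ≡ a
  used a with any? (λ v → f v ≟ a)
  ... | yes u = u
  ... | no ¬u = contradiction (a , λ v eq → ¬u (v , eq)) none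

  collision = pigeonhole n<ℓ (proj₁ ∘ used)
  i = proj₁ collision
  j = proj₁ (proj₂ collision)
  i<j = proj₁ (proj₂ (proj₂ collision))
  same = proj₂ (proj₂ (proj₂ collision))

IsComplete : Graph → Set
IsComplete G = ∀ {u v} → u ≢ v → Graph.Adj G u v

module Complete {G : Graph} (adjacent : IsComplete G) where

  open Graph G using (Adj; irrefl)

  color-injective : ∀ {k} (c : Coloring G k) → Injective _≡_ _≡_ (color c)
  color-injective c {u} {v} eq =
    decidable-stable (u ≟ v) λ u≢v → Coloring.proper c (adjacent u≢v) eq

  module _ {ℓ} (n<ℓ : order G < ℓ) where

    -- The only vertex that can already have color a is first moved to an unused color.
    place : ∀ (d : Coloring G ℓ) x a → Σ[ d′ ∈ Coloring G ℓ ]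
      color d′ x ≡ a × (∀ v → v ≢ x → color d v ≢ a → color d′ v ≡ color d v) ×
      Σ[ w ∈ Walk d d′ ] (∀ v → recolorings v w ≤ 1)
    place d x a with any? (λ y → ¬? (y ≟ x) ×-dec (color d y ≟ a))
    ... | no unused =
      recolor d x a free , updateAt-updates x (color d)
      , (λ v v≢x _ → updateAt-minimal v x (color d) v≢x)
      , proj₁ move , λ v → ≤-trans (proj₂ move v) (changes≤1 _ (color (recolor d x a free) v))
      where
      free : ∀ {v} → Adj x v → color d v ≢ a
      free e eq = unused (_ , (λ v≡x → irrefl (sym v≡x) e) , eq)

      move = recolor-walk d x a free
    ... | yes (y , y≢x , dy≡a) =
      d₂ , updateAt-updates x (color d₁) , kept
      , proj₁ move₁ ++ proj₁ move₂ , bound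
      where
      fresh = freshColor n<ℓ (color d)
      b = proj₁ fresh

      free₁ : ∀ {v} → Adj y v → color d v ≢ b
      free₁ {v} _ = proj₂ fresh v

      d₁ = recolor d y b free₁

      d₁-y : color d₁ y ≡ b
      d₁-y = updateAt-updates y (color d)

      d₁-off : ∀ {v} → v ≢ y → color d₁ v ≡ color d v
      d₁-off {v} = updateAt-minimal v y (color d)

      free₂ : ∀ {v} → Adj x v → color d₁ v ≢ a
      free₂ {v} _ eq with v ≟ y
      ... | yes refl = proj₂ fresh y (trans dy≡a (trans (sym eq) d₁-y))
      ... | no v≢y = v≢y (color-injective d (trans (sym (d₁-off v≢y)) (trans eq (sym dy≡a))))

      d₂ = recolor d₁ x a free₂

      d₂-off : ∀ {v} → v ≢ x → color d₂ v ≡ color d₁ v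
      d₂-off {v} = updateAt-minimal v x (color d₁)

      move₁ = recolor-walk d y b free₁
      move₂ = recolor-walk d₁ x a free₂

      kept : ∀ v → v ≢ x → color d v ≢ a → color d₂ v ≡ color d v
      kept v v≢x dv≢a = trans (d₂-off v≢x) (d₁-off λ { refl → dv≢a dy≡a })

      -- The first move leaves `x` alone and the second every other vertex, so none changes twice.
      once : ∀ v → color d₁ v ≡ color d v ⊎ color d₁ v ≡ color d₂ v
      once v with v ≟ x
      ... | yes refl = inj₁ (d₁-off (≢-sym y≢x))
      ... | no v≢x   = inj₂ (sym (d₂-off v≢x))

      bound : ∀ v → recolorings v (proj₁ move₁ ++ proj₁ move₂) ≤ 1
      bound v = subst (_≤ 1) (sym (recolorings-++ (proj₁ move₁) (proj₁ move₂) v))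
        (≤-trans (+-mono-≤ (proj₂ move₁ v) (proj₂ move₂ v))
          (≤-trans (≤-reflexive (changes-via (once v))) (changes≤1 (color d v) (color d₂ v))))

    -- Placing `color t x` at `x` can displace only a vertex of that color. A vertex outside
    -- `x ∷ xs` has its color from `t`, which is injective, so it stays put. Each placement costs a
    -- vertex at most one change.
    settle : ∀ xs (d t : Coloring G ℓ) → (∀ v → v ∉ xs → color d v ≡ color t v) →
      Σ[ w ∈ Walk d t ] (∀ v → recolorings v w ≤ length xs)
    settle []       d t agree = done (λ v → agree v λ ()) , λ v → z≤n
    settle (x ∷ xs) d t agree with place d x (color t x)
    ... | d′ , at-x , kept , w , w≤1 = w ++ proj₁ rest , λ v →
      subst (_≤ suc (length xs)) (sym (recolorings-++ w (proj₁ rest) v))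
        (+-mono-≤ (w≤1 v) (proj₂ rest v))
      where
      agree′ : ∀ v → v ∉ xs → color d′ v ≡ color t v
      agree′ v v∉ with v ≟ x
      ... | yes refl = at-x
      ... | no v≢x = trans (kept v v≢x λ eq → v≢x (color-injective t (trans (sym dv≡tv) eq))) dv≡tv
        where
        dv≡tv = agree v λ { (here v≡x) → v≢x v≡x ; (there v∈) → v∉ v∈ }

      rest = settle xs d′ t agree′

  -- Here χ is the order, so `ℓ` exceeds the number of vertices and `place` has its spare color. One
  -- placement per vertex meets the bound.
  complete⇒collapsible : ∀ {Counted} → Collapsible Counted G
  complete⇒collapsible = order G , (identity , minimal) , identity , λ ℓ n<ℓ d →
    let w , le = settle n<ℓ (allFin (order G)) d (weaken (<⇒≤ n<ℓ) identity)
                   λ v v∉ → contradiction (∈-allFin v) v∉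
    in w , λ _ v → subst (recolorings v w ≤_) (length-tabulate {n = order G} (λ i → i)) (le v)
    where
    identity : Coloring G (order G)
    identity = record { color = λ v → v ; proper = λ e u≡v → irrefl u≡v e }

    minimal : ∀ j → j < order G → ¬ Coloring G j
    minimal j j<n c with pigeonhole j<n (color c)
    ... | u , v , u<v , eq = <⇒≢ u<v (color-injective c eq)

-- Disjoint unions

module DisjointUnion {G : Graph} {S : Vertex G → Set} (S? : Unary.Decidable S)
                     (closed : ∀ {u v} → Graph.Adj G u v → S u → S v) where

  private
    module A = Induced G S?
    module B = Induced G (λ v → ¬? (S? v))

    closed′ : ∀ {u v} → Graph.Adj G u v → ¬ S u → ¬ S v
    closed′ a ¬s t = ¬s (closed (Graph.symm G a) t)

  combine : ∀ {k} → Coloring A.graph k → Coloring B.graph k → Coloring G k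
  combine {k} a b = record { color = color′ ; proper = λ {u} {v} → proper′ {u} {v} }
    where
    color′ : Vertex G → Fin k
    color′ v with S? v
    ... | yes s = color a (A.preimage s)
    ... | no ¬s = color b (B.preimage ¬s)

    proper′ : ∀ {u v} → Graph.Adj G u v → color′ u ≢ color′ v
    proper′ {u} {v} e with S? u | S? v
    ... | yes s | yes t = Coloring.proper a (A.preimage-adj s t e)
    ... | yes s | no ¬t = contradiction (closed e s) ¬t
    ... | no ¬s | yes t = contradiction (closed (Graph.symm G e) t) ¬s
    ... | no ¬s | no ¬t = Coloring.proper b (B.preimage-adj ¬s ¬t e)

  -- The two sides are recolored in turn, each while the other stays fixed. A vertex is charged on
  -- its own side only, and that side has at most `order G` vertices.
  union-collapsible : ∀ {Counted} → Collapsible Counted A.graph → Collapsible Counted B.graph →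
    Collapsible Counted G
  union-collapsible {Counted} (χ₁ , (_ , minimal₁) , c₁ , reach₁) (χ₂ , (_ , minimal₂) , c₂ , reach₂) =
    χ₁ ⊔ χ₂ , (c , minimal) , c , reach
    where
    c : Coloring G (χ₁ ⊔ χ₂)
    c = combine (weaken (m≤m⊔n χ₁ χ₂) c₁) (weaken (m≤n⊔m χ₁ χ₂) c₂)

    minimal : ∀ j → j < χ₁ ⊔ χ₂ → ¬ Coloring G j
    minimal j j< e with ⊔-sel χ₁ χ₂
    ... | inj₁ eq = minimal₁ j (subst (j <_) eq j<) (restrict A.inclusion e)
    ... | inj₂ eq = minimal₂ j (subst (j <_) eq j<) (restrict B.inclusion e)

    reach : ∀ ℓ (χ<ℓ : χ₁ ⊔ χ₂ < ℓ) (d : Coloring G ℓ) →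
      Σ[ w ∈ Walk d (weaken (<⇒≤ χ<ℓ) c) ] (Counted → ∀ v → recolorings v w ≤ order G)
    reach ℓ χ<ℓ d = proj₁ walk₁ ++ proj₁ walk₂ , bound
      where
      χ₁<ℓ = ≤-<-trans (m≤m⊔n χ₁ χ₂) χ<ℓ
      χ₂<ℓ = ≤-<-trans (m≤n⊔m χ₁ χ₂) χ<ℓ

      module PA = PullBack A.project (A.project-hom closed) d

      reachA = reach₁ ℓ χ₁<ℓ (restrict A.inclusion d)

      d₁ = PA.overlay (weaken (<⇒≤ χ₁<ℓ) c₁)

      -- With `d₁` as the base, the side already recolored keeps its target colors.
      module PB = PullBack B.project (B.project-hom closed′) d₁

      reachB = reach₂ ℓ χ₂<ℓ (restrict B.inclusion d₁)

      -- Enlarging the palette by way of the maximum or directly to `ℓ` gives the same color.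
      final : color (weaken (<⇒≤ χ<ℓ) c) ≗ color (PB.overlay (weaken (<⇒≤ χ₂<ℓ) c₂))
      final v with S? v
      ... | yes s = inject≤-idempotent (color c₁ (A.preimage s)) _ _ _
      ... | no ¬s = inject≤-idempotent (color c₂ (B.preimage ¬s)) _ _ _

      walk₁ = PA.pullBack (proj₁ reachA) d d₁ (sym ∘ A.project-restrict d) (λ _ → refl)
      walk₂ = PB.pullBack (proj₁ reachB) d₁ (weaken (<⇒≤ χ<ℓ) c)
                (sym ∘ B.project-restrict d₁) final

      cost : Counted → ∀ v →
        maybe′ (λ x → recolorings x (proj₁ reachA)) 0 (A.project v) +
        maybe′ (λ x → recolorings x (proj₁ reachB)) 0 (B.project v) ≤ order G
      cost counted v with S? v
      ... | yes s = subst (_≤ order G) (sym (+-identityʳ _)) (≤-trans (proj₂ reachA counted _) A.order≤)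
      ... | no ¬s = ≤-trans (proj₂ reachB counted _) B.order≤

      bound : Counted → ∀ v → recolorings v (proj₁ walk₁ ++ proj₁ walk₂) ≤ order G
      bound counted v = subst (_≤ order G) (sym (recolorings-++ (proj₁ walk₁) (proj₁ walk₂) v))
        (≤-trans (+-mono-≤ (proj₂ walk₁ v) (proj₂ walk₂ v)) (cost counted v))

-- Dominated vertices

module Dominated {G : Graph} {u v : Vertex G} (u≢v : u ≢ v)
                 (dominated : ∀ {w} → Graph.Adj G v w → Graph.Adj G u w) where

  open Graph G using (Adj; symm; irrefl)

  module Rest = Induced G (λ w → ¬? (w ≟ v))

  private
    fold : Vertex G → Vertex G
    fold w with w ≟ v
    ... | yes _ = u
    ... | no  _ = w

    fold≢v : ∀ w → fold w ≢ v
    fold≢v w with w ≟ v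
    ... | yes _   = u≢v
    ... | no  w≢v = w≢v

    -- Only one end is folded, because the first sweep below compares `d` at one end with the folded
    -- coloring at the other.
    fold-adjʳ : ∀ {x y} → Adj x y → Adj x (fold y)
    fold-adjʳ {x} {y} a with y ≟ v
    ... | yes refl = symm (dominated (symm a))
    ... | no _ = a

    fold-adj : ∀ {x y} → Adj x y → Adj (fold x) (fold y)
    fold-adj {x} {y} a with x ≟ v | y ≟ v
    ... | yes refl | yes refl = contradiction a (irrefl refl)
    ... | yes refl | no _     = dominated a
    ... | no _     | yes refl = symm (dominated (symm a))
    ... | no _     | no _     = a

    retract : Vertex G → Vertex Rest.graph
    retract w = Rest.preimage (fold≢v w)

    retract-adj : ∀ {x y} → Adj x y → Graph.Adj Rest.graph (retract x) (retract y)
    retract-adj {x} {y} a = Rest.preimage-adj (fold≢v x) (fold≢v y) (fold-adj a)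

  -- Sending `v` to `u` is a retraction onto the rest of `G`, so colorings and walks there pull
  -- back. Restriction shows that χ does not drop.
  dominated-collapsible : ∀ {Counted} → Collapsible Counted Rest.graph → Collapsible Counted G
  dominated-collapsible {Counted} (χ , (_ , minimal) , c , reach) =
    χ , (c′ , λ j j<χ e → minimal j j<χ (restrict Rest.inclusion e)) , c′ , reach′
    where
    c′ : Coloring G χ
    c′ = record { color = color c ∘ retract ; proper = Coloring.proper c ∘ retract-adj }

    reach′ : ∀ ℓ (χ<ℓ : χ < ℓ) (d : Coloring G ℓ) →
      Σ[ w ∈ Walk d (weaken (<⇒≤ χ<ℓ) c′) ] (Counted → ∀ v → recolorings v w ≤ order G)
    reach′ ℓ χ<ℓ d = proj₁ walk₁ ++ proj₁ walk₂ , bound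
      where
      module P = PullBack {G} {Rest.graph} (just ∘ retract) (just ∘ retract-adj) d

      e = restrict Rest.inclusion d

      reached = reach ℓ χ<ℓ e

      -- The overlay gives `y` the color of `fold y` under `d`, and `x` is adjacent to `fold y`.
      walk₁ = sweep d (P.overlay e) λ {x} {y} a eq →
        Coloring.proper d (fold-adjʳ a)
          (trans eq (cong (color d) (Rest.embed-preimage (fold≢v y))))

      walk₂ = P.pullBack (proj₁ reached) (P.overlay e) (weaken (<⇒≤ χ<ℓ) c′)
                (λ _ → refl) (λ _ → refl)

      bound : Counted → ∀ x → recolorings x (proj₁ walk₁ ++ proj₁ walk₂) ≤ order G
      bound counted x = subst (_≤ order G) (sym (recolorings-++ (proj₁ walk₁) (proj₁ walk₂) x))
        -- One change in the sweep and at most `order Rest.graph` afterwards; the deleted vertex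
        -- makes room for the extra one.
        (≤-trans (+-mono-≤ (≤-trans (proj₂ walk₁ x) (changes≤1 (color d x) (color (P.overlay e) x)))
                           (≤-trans (proj₂ walk₂ x) (proj₂ reached counted (retract x))))
                 (Rest.order< λ v≢v → v≢v refl))

-- Paw-free graphs

triangle-in-paw : triangle InducedIn paw
triangle-in-paw = record
  { embed     = suc
  ; injective = λ { refl → refl }
  ; adjacency = λ _ _ → mk⇔ (λ a → a) (λ a → a)
  }

module _ {G : Graph} where

  open Graph G using (Adj; symm; irrefl; adj?)

  triangleAt : ∀ {a b c} → Adj a b → Adj a c → Adj b c → triangle InducedIn G
  triangleAt {a} {b} {c} ab ac bc = record
    { embed = embed ; injective = λ {u} {v} → injective u v ; adjacency = adjacency }
    where
    embed : Fin 3 → Vertex G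
    embed zero             = a
    embed (suc zero)       = b
    embed (suc (suc zero)) = c

    adj : ∀ u v → u ≢ v → Adj (embed u) (embed v)
    adj zero zero ne = contradiction refl ne
    adj zero (suc zero) ne = ab
    adj zero (suc (suc zero)) ne = ac
    adj (suc zero) zero ne = symm ab
    adj (suc zero) (suc zero) ne = contradiction refl ne
    adj (suc zero) (suc (suc zero)) ne = bc
    adj (suc (suc zero)) zero ne = symm ac
    adj (suc (suc zero)) (suc zero) ne = symm bc
    adj (suc (suc zero)) (suc (suc zero)) ne = contradiction refl ne

    injective : ∀ u v → embed u ≡ embed v → u ≡ v
    injective u v eq = decidable-stable (u ≟ v) λ ne → irrefl eq (adj u v ne)

    adjacency : ∀ u v → u ≢ v ⇔ Adj (embed u) (embed v)
    adjacency u v = mk⇔ (adj u v) λ { e refl → irrefl refl e }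

  pawAt : ∀ {a b c d} → Adj a b → Adj a c → Adj b c → Adj d a → ¬ Adj d b → ¬ Adj d c →
    paw InducedIn G
  pawAt {a} {b} {c} {d} ab ac bc da ¬db ¬dc = record
    { embed = embed ; injective = λ {u} {v} → injective u v ; adjacency = adjacency }
    where
    module T = _InducedIn_ (triangleAt ab ac bc)

    embed : Fin 4 → Vertex G
    embed zero    = d
    embed (suc i) = T.embed i

    -- If `d` were `b` or `c`, it would be adjacent to the other of the two.
    d≢ : ∀ i → d ≢ T.embed i
    d≢ zero             refl = irrefl refl da
    d≢ (suc zero)       refl = ¬dc bc
    d≢ (suc (suc zero)) refl = ¬db (symm bc)

    injective : ∀ u v → embed u ≡ embed v → u ≡ v
    injective zero    zero    _  = refl
    injective zero    (suc v) eq = contradiction eq (d≢ v)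
    injective (suc u) zero    eq = contradiction (sym eq) (d≢ u)
    injective (suc u) (suc v) eq = cong suc (T.injective eq)

    leaf : ∀ i → i ≡ zero ⇔ Adj d (T.embed i)
    leaf zero             = mk⇔ (λ _ → da) (λ _ → refl)
    leaf (suc zero)       = mk⇔ (λ ()) (λ e → contradiction e ¬db)
    leaf (suc (suc zero)) = mk⇔ (λ ()) (λ e → contradiction e ¬dc)

    adjacency : ∀ u v → Graph.Adj paw u v ⇔ Adj (embed u) (embed v)
    adjacency zero    zero    = mk⇔ (λ ()) (irrefl refl)
    adjacency zero    (suc v) = leaf v
    adjacency (suc u) zero    = mk⇔ (symm ∘ Equivalence.to (leaf u)) (Equivalence.from (leaf u) ∘ symm)
    adjacency (suc u) (suc v) = T.adjacency u v

  -- Otherwise `d` would complete the triangle to an induced paw. `d` may lie on the triangle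
  -- itself: as `b` or `c` it is adjacent to the other.
  second-neighbor : ¬ (paw InducedIn G) → ∀ {a b c d} → Adj a b → Adj a c → Adj b c → Adj d a →
    Adj d b ⊎ Adj d c
  second-neighbor paw-free {b = b} {c} {d} ab ac bc da with adj? d b | adj? d c
  ... | yes db | _      = inj₁ db
  ... | no _   | yes dc = inj₂ dc
  ... | no ¬db | no ¬dc = contradiction (pawAt ab ac bc da ¬db ¬dc) paw-free

  -- A triangle `v z y` and a further vertex `u` adjacent to `z` but not to `v`. In a paw-free graph
  -- `u` is then adjacent to `y`, whence the name.
  Diamond : Set
  Diamond = ∃[ u ] ∃[ v ] ∃[ z ] ∃[ y ]
    u ≢ v × ¬ Adj u v × Adj u z × Adj v z × Adj v y × Adj z y

  diamond? : Dec Diamond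
  diamond? = any? λ u → any? λ v → any? λ z → any? λ y →
    ¬? (u ≟ v) ×-dec ¬? (adj? u v) ×-dec adj? u z ×-dec adj? v z ×-dec adj? v y ×-dec adj? z y

  -- Every neighbor w of v forms a triangle vwp with p ∈ {z, y}, and u is adjacent to p.
  diamond⇒dominated : ¬ (paw InducedIn G) → ∀ {u v z y} →
    ¬ Adj u v → Adj u z → Adj v z → Adj v y → Adj z y → ∀ {w} → Adj v w → Adj u w
  diamond⇒dominated paw-free {u} {v} {z} {y} ¬uv uz vz vy zy {w} vw =
    [ (λ wz → via uz vz wz) , (λ wy → via uy vy wy) ]′ (second-neighbor paw-free vz vy zy (symm vw))
    where
    via : ∀ {p} → Adj u p → Adj v p → Adj w p → Adj u w
    via up vp wp =
      [ (λ uv → contradiction uv ¬uv) , (λ uw → uw) ]′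
        (second-neighbor paw-free (symm vp) (symm wp) vw up)

    uy : Adj u y
    uy = [ (λ uv → contradiction uv ¬uv) , (λ e → e) ]′ (second-neighbor paw-free (symm vz) zy vy uz)

  Triangle : Set
  Triangle = ∃[ a ] ∃[ b ] ∃[ c ] Adj a b × Adj a c × Adj b c

  triangle? : Dec Triangle
  triangle? = any? λ a → any? λ b → any? λ c → adj? a b ×-dec adj? a c ×-dec adj? b c

  triangle⇒Triangle : triangle InducedIn G → Triangle
  triangle⇒Triangle i =
    embed zero , embed (suc zero) , embed (suc (suc zero)) , edge (λ ()) , edge (λ ()) , edge (λ ())
    where
    open _InducedIn_ i

    edge : ∀ {u v} → u ≢ v → Adj (embed u) (embed v)
    edge = Equivalence.to (adjacency _ _)

  module CliqueComponent (paw-free : ¬ (paw InducedIn G)) (¬diamond : ¬ Diamond)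
                         {a b c : Vertex G} (ab : Adj a b) (ac : Adj a c) (bc : Adj b c) where

    N[a] : Vertex G → Set
    N[a] v = v ≡ a ⊎ Adj v a

    N[a]? : Unary.Decidable N[a]
    N[a]? v = (v ≟ a) ⊎-dec adj? v a

    private
      -- Every edge at `a` lies in a triangle; its third vertex is the `y` that `join` asks for.
      common : ∀ {x} → Adj x a → ∃[ y ] Adj a y × Adj x y
      common xa with second-neighbor paw-free ab ac bc xa
      ... | inj₁ xb = b , ab , xb
      ... | inj₂ xc = c , ac , xc

      join : ∀ {u v z y} → u ≢ v → Adj u z → Adj v z → Adj v y → Adj z y → Adj u v
      join {u} {v} u≢v uz vz vy zy =
        decidable-stable (adj? u v) λ ¬uv → ¬diamond (_ , _ , _ , _ , u≢v , ¬uv , uz , vz , vy , zy)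

    N[a]-closed : ∀ {u v} → Adj u v → N[a] u → N[a] v
    N[a]-closed av (inj₁ refl) = inj₂ (symm av)
    N[a]-closed {u} {v} uv (inj₂ ua) with v ≟ a
    ... | yes v≡a = inj₁ v≡a
    ... | no  v≢a =
      -- `v` and `a` have the common neighbor `u`, and `a u y` is a triangle.
      let y , ay , uy = common ua in inj₂ (join v≢a (symm uv) (symm ua) ay uy)

    N[a]-clique : ∀ {u v} → N[a] u → N[a] v → u ≢ v → Adj u v
    N[a]-clique (inj₁ refl) (inj₁ refl) u≢v = contradiction refl u≢v
    N[a]-clique (inj₁ refl) (inj₂ va)   u≢v = symm va
    N[a]-clique (inj₂ ua)   (inj₁ refl) u≢v = ua
    N[a]-clique (inj₂ ua)   (inj₂ va)   u≢v = let y , ay , vy = common va in join u≢v ua va vy ay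

-- Induction on the order and the two equivalences

module _ {H : Graph} {Counted : Set} where

  free-induced : ∀ {F G K} → K InducedIn G → Free F H G → Free F H K
  free-induced i (F-free , H-free) =
    (λ j → F-free (InducedIn-trans j i)) , (λ j → H-free (InducedIn-trans j i))

  -- Both reductions pass to a smaller induced subgraph, which inherits freeness. Once no triangle
  -- is left, the hypothesis applies.
  paw-free-collapsible : (∀ G → Free triangle H G → Collapsible Counted G) →
    ∀ G → Free paw H G → Collapsible Counted G
  paw-free-collapsible triangle-free G = go G (<-wellFounded (order G))
    where
    go : ∀ G → Acc _<_ (order G) → Free paw H G → Collapsible Counted G
    go G (acc rec) free@(paw-free , H-free) with triangle? {G}
    ... | no ¬triangle = triangle-free G (¬triangle ∘ triangle⇒Triangle , H-free)
    ... | yes (a , b , c , ab , ac , bc) with diamond? {G}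
    ...   | yes (u , v , z , y , u≢v , ¬uv , uz , vz , vy , zy) =
      dominated-collapsible
        (go Rest.graph (rec (Rest.order< λ v≢v → v≢v refl)) (free-induced Rest.inclusion free))
      where
      open Dominated {G} u≢v (diamond⇒dominated {G} paw-free ¬uv uz vz vy zy)
    ...   | no ¬diamond =
      DisjointUnion.union-collapsible {G} N[a]? N[a]-closed
        (Complete.complete⇒collapsible {Clique.graph} λ {i} {j} i≢j →
          N[a]-clique (Clique.embed∈ i) (Clique.embed∈ j)
            (i≢j ∘ _InducedIn_.injective Clique.inclusion))
        -- The vertex `a` lies in the clique, so the remaining graph is smaller.
        (go Others.graph (rec (Others.order< λ a∉ → a∉ (inj₁ refl))) (free-induced Others.inclusion free))
      where
      open CliqueComponent {G} paw-free ¬diamond ab ac bc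
      module Clique = Induced G N[a]?
      module Others = Induced G (λ v → ¬? (N[a]? v))

theorem6 : (H : Graph) →
    ((∀ G → Free triangle H G → Recolorable G) ⇔ (∀ G → Free paw H G → Recolorable G))
    × ((∀ G → Free triangle H G → Good G) ⇔ (∀ G → Free paw H G → Good G))
theorem6 H =
  mk⇔ (λ hyp G free → collapsible⇒recolorable
        (paw-free-collapsible (λ K → recolorable⇒collapsible ∘ hyp K) G free))
      (λ hyp G free → hyp G (weaker free))
  , mk⇔ (λ hyp G free → collapsible⇒good
          (paw-free-collapsible (λ K → good⇒collapsible ∘ hyp K) G free))
        (λ hyp G free → hyp G (weaker free))
  where
  weaker : ∀ {G} → Free triangle H G → Free paw H G
  weaker (triangle-free , H-free) = triangle-free ∘ InducedIn-trans triangle-in-paw , H-free
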